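{- For every $m \in \mathbb{N}$, the $m$-uniform hypergraph $\mathcal{H}_m = (V, \mathcal{E}_s \cup \mathcal{E}_p)$ defined below admits no polychromatic coloring with $2$ colors, i.e., for every coloring $\phi\colon V \to \{\text{red},\text{blue}\}$ some hyperedge of $\mathcal{H}_m$ is monochromatic.
   Context: Construction of $\mathcal{H}_m$: first a rooted forest $F_m$ with $m^m$ trees is built, whose vertices are partitioned into "stages"; each stage $S$ carries a total order $<_S$, and all vertices of a stage have the same distance $j$ (the level of $S$) to the root of their tree; a stage on level $j \in \{0,\dots,m-1\}$ has $m^{m-j}$ vertices. Start with $m^m$ roots, which form the unique stage on level $0$, ordered in an arbitrary fixed way. Then, for every already defined stage $S$ on level $j < m-1$ and every subset $S' \subseteq S$ with $|S'| = m^{m-j-1}$, add a new stage $T(S')$ on level $j+1$ consisting of $m^{m-j-1}$ new vertices such that every vertex of $S'$ gets exactly one child from $T(S')$, and order $T(S')$ by $<_{T(S')}$ as their parents are ordered by $<_S$. The hypergraph $\mathcal{H}_m$ has vertex set $V = V(F_m)$ and two kinds of hyperedges: stage-hyperedges $\mathcal{E}_s$, namely for every stage $S$ each set of $m$ consecutive vertices in $<_S$; and path-hyperedges $\mathcal{E}_p$, namely the vertex set of every root-to-leaf path in $F_m$ (leaves are on level $m-1$). A $2$-coloring is polychromatic if every hyperedge contains vertices of both colors. -}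

module Defs where

open import Data.Bool.Base using (true; false)
open import Data.Fin.Base as Fin using (Fin; zero; suc; toℕ; fromℕ<; cast)
open import Data.Fin.Properties using (toℕ-injective; toℕ-fromℕ<; toℕ<n)
open import Data.Fin.Subset using (Subset; ∣_∣) renaming (_∈_ to _∈ˢ_)
open import Data.Nat.Base using (ℕ; zero; suc; _+_; _∸_; _^_; _≤_; _<_; z<s; s<s)
open import Data.Nat.Properties
  using (<-≤-trans; m≤m+n; +-monoʳ-<; +-cancelˡ-≡; +-cancelˡ-<; m+[n∸m]≡n; +-identityʳ; +-suc)
open import Data.Product.Base using (∃; _×_; _,_)
open import Data.Sum.Base using (inj₁; inj₂; [_,_])
open import Data.Vec.Base using (_∷_; here; there)
open import Function.Base using (_∘_)
open import Function.Definitions using (Injective)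
open import Level using (0ℓ)
open import Relation.Binary.Construct.Closure.ReflexiveTransitive using (Star; ε; _◅_)
open import Relation.Binary.PropositionalEquality
  using (_≡_; refl; sym; trans; cong; subst)
open import Relation.Unary using (Pred; _∈_; _∪_; _≐_; ｛_｝)

------------------------------------------------------------------------
-- Hypergraphs and colorings

HasSize : {A : Set} → ℕ → Pred A 0ℓ → Set
HasSize {A} n P =
  ∃ λ (f : Fin n → A) → Injective _≡_ _≡_ f × (P ≐ λ a → ∃ λ i → f i ≡ a)

HasSize-resp : {A : Set} {n : ℕ} {P Q : Pred A 0ℓ} → P ≐ Q → HasSize n Q → HasSize n P
HasSize-resp (P⊆Q , Q⊆P) (f , inj , Q⊆f , f⊆Q) = f , inj , Q⊆f ∘ P⊆Q , Q⊆P ∘ f⊆Q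

record UniformHypergraph (m : ℕ) : Set₁ where
  field
    Vertex  : Set
    Edge    : Pred (Pred Vertex 0ℓ) 0ℓ
    uniform : ∀ {e} → e ∈ Edge → HasSize m e

data Color : Set where
  red blue : Color

module _ {m : ℕ} (H : UniformHypergraph m) where
  open UniformHypergraph H

  Coloring : Set
  Coloring = Vertex → Color

  Polychromatic : Coloring → Set₁
  Polychromatic φ = ∀ e → e ∈ Edge → ∀ c → ∃ λ v → v ∈ e × φ v ≡ c

  Monochromatic : Coloring → Pred Vertex 0ℓ → Set
  Monochromatic φ e = ∃ λ c → ∀ v → v ∈ e → φ v ≡ c

------------------------------------------------------------------------
-- The increasing enumeration of a subset of Fin n

enum : ∀ {n} (p : Subset n) → Fin ∣ p ∣ → Fin n
enum (true  ∷ p) zero    = zero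
enum (true  ∷ p) (suc i) = suc (enum p i)
enum (false ∷ p) i       = suc (enum p i)

enum-∈ : ∀ {n} (p : Subset n) i → enum p i ∈ˢ p
enum-∈ (true  ∷ p) zero    = here
enum-∈ (true  ∷ p) (suc i) = there (enum-∈ p i)
enum-∈ (false ∷ p) i       = there (enum-∈ p i)

enum-mono-< : ∀ {n} (p : Subset n) {i j} → i Fin.< j → enum p i Fin.< enum p j
enum-mono-< (true  ∷ p) {zero}  {suc j} _         = z<s
enum-mono-< (true  ∷ p) {suc i} {suc j} (s<s i<j) = s<s (enum-mono-< p i<j)
enum-mono-< (false ∷ p)                 i<j       = s<s (enum-mono-< p i<j)

enum-surjective : ∀ {n} (p : Subset n) {x} → x ∈ˢ p → ∃ λ i → enum p i ≡ x
enum-surjective (true ∷ p) here = zero , refl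
enum-surjective (true ∷ p) (there x∈p) with enum-surjective p x∈p
... | i , eq = suc i , cong suc eq
enum-surjective (false ∷ p) (there x∈p) with enum-surjective p x∈p
... | i , eq = i , cong suc eq

------------------------------------------------------------------------
-- The hypergraph ℋ m

module Construction (m : ℕ) where

  size : ℕ → ℕ
  size j = m ^ (m ∸ j)

  -- The index is the level.  A stage S on level j has Fin (size j) as its set
  -- of vertices, and <_S is the usual order on Fin (size j).  The arguments
  -- j+1<m and ∣S′∣≡ are irrelevant so that there is exactly one T(S′) per S′.
  data Stage : ℕ → Set where
    roots : Stage 0
    T     : ∀ {j} .(j+1<m : suc j < m) (S : Stage j) (S′ : Subset (size j))
            .(∣S′∣≡ : ∣ S′ ∣ ≡ size (suc j)) → Stage (suc j)

  record V : Set where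
    constructor vertex
    field
      {level}  : ℕ
      stage    : Stage level
      position : Fin (size level)

  open V public

  infix 4 _⟶_

  -- Parent to child: the i-th vertex of T(S′) is the child of the i-th
  -- vertex of S′ with respect to <_S.
  data _⟶_ : V → V → Set where
    child : ∀ {j} .(j+1<m : suc j < m) (S : Stage j) (S′ : Subset (size j))
            .(∣S′∣≡ : ∣ S′ ∣ ≡ size (suc j)) (i : Fin (size (suc j))) →
            vertex S (enum S′ (cast (sym ∣S′∣≡) i)) ⟶ vertex (T j+1<m S S′ ∣S′∣≡) i

  Root Leaf : Pred V 0ℓ
  Root v = level v ≡ 0
  Leaf v = suc (level v) ≡ m

  -- The vertices of S at positions i, …, i + m ∸ 1.
  Window : ∀ {j} → Stage j → ℕ → Pred V 0ℓ
  Window S i v = ∃ λ p → v ≡ vertex S p × i ≤ toℕ p × toℕ p < i + m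

  OnPath : ∀ {u v} → Star _⟶_ u v → Pred V 0ℓ
  OnPath {u} ε       = ｛ u ｝
  OnPath {u} (_ ◅ π) = ｛ u ｝ ∪ OnPath π

  StageEdge PathEdge : Pred (Pred V 0ℓ) 0ℓ
  StageEdge e = ∃ λ j → ∃ λ (S : Stage j) → ∃ λ i → i + m ≤ size j × e ≐ Window S i
  PathEdge  e = ∃ λ r → ∃ λ l → Root r × Leaf l × ∃ λ (π : Star _⟶_ r l) → e ≐ OnPath π

  Window-size : ∀ {j} (S : Stage j) {i} → i + m ≤ size j → HasSize m (Window S i)
  Window-size {j} S {i} i+m≤ = f , f-injective , to , from
    where
    bound : ∀ (k : Fin m) → i + toℕ k < size j
    bound k = <-≤-trans (+-monoʳ-< i (toℕ<n k)) i+m≤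

    f : Fin m → V
    f k = vertex S (fromℕ< (bound k))

    toℕ-f : ∀ k → toℕ (position (f k)) ≡ i + toℕ k
    toℕ-f k = toℕ-fromℕ< (bound k)

    f-injective : Injective _≡_ _≡_ f
    f-injective {k} {l} eq = toℕ-injective (+-cancelˡ-≡ i _ _
      (trans (sym (toℕ-f k)) (trans (cong (toℕ ∘ position) eq) (toℕ-f l))))

    to : ∀ {v} → Window S i v → ∃ λ k → f k ≡ v
    to (p , refl , i≤p , p<i+m) = fromℕ< k<m , cong (vertex S) (toℕ-injective
      (trans (toℕ-f (fromℕ< k<m)) (trans (cong (i +_) (toℕ-fromℕ< k<m)) (m+[n∸m]≡n i≤p))))
      where
      k<m : toℕ p ∸ i < m
      k<m = +-cancelˡ-< i _ _ (subst (_< i + m) (sym (m+[n∸m]≡n i≤p)) p<i+m)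

    from : ∀ {v} → (∃ λ k → f k ≡ v) → Window S i v
    from (k , refl) = fromℕ< (bound k) , refl ,
      subst (i ≤_) (sym (toℕ-f k)) (m≤m+n i _) ,
      subst (_< i + m) (sym (toℕ-f k)) (+-monoʳ-< i (toℕ<n k))

  length : ∀ {u v} → Star _⟶_ u v → ℕ
  length ε       = 0
  length (_ ◅ π) = suc (length π)

  level-⟶ : ∀ {u v} → u ⟶ v → level v ≡ suc (level u)
  level-⟶ (child _ _ _ _ _) = refl

  level-path : ∀ {u v} (π : Star _⟶_ u v) → level v ≡ level u + length π
  level-path {u} ε       = sym (+-identityʳ (level u))
  level-path {u} (s ◅ π) = trans (level-path π)
    (trans (cong (_+ length π) (level-⟶ s)) (sym (+-suc (level u) (length π))))

  OnPath-size : ∀ {u v} (π : Star _⟶_ u v) → HasSize (suc (length π)) (OnPath π)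
  OnPath-size π = at π , at-injective , to π , from π
    where
    at : ∀ {u v} (π : Star _⟶_ u v) → Fin (suc (length π)) → V
    at {u} π       zero    = u
    at     (_ ◅ π) (suc i) = at π i

    level-at : ∀ {u v} (π : Star _⟶_ u v) i → level (at π i) ≡ level u + toℕ i
    level-at {u} ε       zero    = sym (+-identityʳ (level u))
    level-at {u} (_ ◅ _) zero    = sym (+-identityʳ (level u))
    level-at {u} (s ◅ π) (suc i) = trans (level-at π i)
      (trans (cong (_+ toℕ i) (level-⟶ s)) (sym (+-suc (level u) (toℕ i))))

    at-injective : Injective _≡_ _≡_ (at π)
    at-injective {i} {k} eq = toℕ-injective (+-cancelˡ-≡ _ _ _
      (trans (sym (level-at π i)) (trans (cong level eq) (level-at π k))))

    to : ∀ {u v} (π : Star _⟶_ u v) {w} → OnPath π w → ∃ λ i → at π i ≡ w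
    to ε       refl        = zero , refl
    to (_ ◅ π) (inj₁ refl) = zero , refl
    to (_ ◅ π) (inj₂ w∈π) with to π w∈π
    ... | i , eq = suc i , eq

    from : ∀ {u v} (π : Star _⟶_ u v) {w} → (∃ λ i → at π i ≡ w) → OnPath π w
    from ε       (zero  , eq) = eq
    from (_ ◅ π) (zero  , eq) = inj₁ eq
    from (_ ◅ π) (suc i , eq) = inj₂ (from π (i , eq))

  StageEdge-size : ∀ {e} → StageEdge e → HasSize m e
  StageEdge-size (_ , S , _ , i+m≤ , e≐) = HasSize-resp e≐ (Window-size S i+m≤)

  PathEdge-size : ∀ {e} → PathEdge e → HasSize m e
  PathEdge-size {e} (_ , _ , root , leaf , π , e≐) =
    subst (λ n → HasSize n e) length≡m (HasSize-resp e≐ (OnPath-size π))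
    where
    length≡m : suc (length π) ≡ m
    length≡m = trans (cong suc (sym (trans (level-path π) (cong (_+ length π) root)))) leaf

ℋ : (m : ℕ) → UniformHypergraph m
ℋ m = record
  { Vertex  = V
  ; Edge    = StageEdge ∪ PathEdge
  ; uniform = [ StageEdge-size , PathEdge-size ]
  }
  where open Construction m

{-# OPTIONS --safe #-}
-- If every stage-hyperedge contains a red vertex, then the m^(m-j-1) disjoint
-- windows of a stage S on level j each supply one; these red vertices form an
-- S′, and the argument repeats in T(S′).  On level m-1 this ends at a red leaf
-- all of whose ancestors are red.
module Submission where

open import Data.Bool.Base using (true; false)
open import Data.Fin.Base using (Fin; zero; suc; toℕ; cast; splitAt; _↑ˡ_; _↑ʳ_)
open import Data.Fin.Properties using (any?; toℕ-↑ˡ; toℕ-↑ʳ; toℕ<n; splitAt⁻¹-↑ˡ; splitAt⁻¹-↑ʳ)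
open import Data.Fin.Subset using (Subset; ∣_∣; ⁅_⁆) renaming (_∈_ to _∈ˢ_)
open import Data.Fin.Subset.Properties using (∣⁅x⁆∣≡1; x∈⁅y⁆⇒x≡y)
open import Data.Nat.Base using (ℕ; zero; suc; _+_; _*_; _∸_; _^_; _≤_; _<_; z≤n)
open import Data.Nat.Properties
  using (m≤m+n; m≤n+m; +-monoʳ-≤; +-cancelˡ-≤; +-cancelˡ-<; +-assoc; +-suc; +-comm; +-∸-assoc;
         *-comm; n∸n≡0; <⇒≱; m+n≤o⇒m≤o)
open import Data.Product.Base using (∃; _×_; _,_)
open import Data.Sum.Base using (_⊎_; inj₁; inj₂)
open import Data.Vec.Base using ([]; _∷_; _++_; here; there)
open import Function.Base using (_∘_; id)
open import Level using (0ℓ)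
open import Relation.Binary.Construct.Closure.ReflexiveTransitive using (Star; ε; _◅_)
open import Relation.Binary.PropositionalEquality
  using (_≡_; refl; sym; trans; cong; cong₂; subst)
open import Relation.Nullary.Decidable.Core using (yes; no)
open import Relation.Nullary.Negation.Core using (¬_; contradiction)
open import Relation.Unary using (Pred; Decidable; _∈_)
open import Defs

∣p++q∣≡∣p∣+∣q∣ : ∀ {a b} (p : Subset a) (q : Subset b) → ∣ p ++ q ∣ ≡ ∣ p ∣ + ∣ q ∣
∣p++q∣≡∣p∣+∣q∣ []          q = refl
∣p++q∣≡∣p∣+∣q∣ (true  ∷ p) q = cong suc (∣p++q∣≡∣p∣+∣q∣ p q)
∣p++q∣≡∣p∣+∣q∣ (false ∷ p) q = ∣p++q∣≡∣p∣+∣q∣ p q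

all-++ : ∀ {a b} (P : Pred (Fin (a + b)) 0ℓ) (p : Subset a) (q : Subset b) →
         (∀ {x} → x ∈ˢ p → P (x ↑ˡ b)) → (∀ {x} → x ∈ˢ q → P (a ↑ʳ x)) →
         ∀ {x} → x ∈ˢ p ++ q → P x
all-++ P []      q P-p P-q x∈q         = P-q x∈q
all-++ P (_ ∷ p) q P-p P-q here        = P-p here
all-++ P (_ ∷ p) q P-p P-q (there x∈)  = all-++ (P ∘ suc) p q (P-p ∘ there) P-q x∈

-- Stated for bare positions, so that the selection argument needs neither stages nor colors; for a
-- stage `S` the bounds on `p` are those of `Window S i`.
MissedWindow : ∀ (m : ℕ) {N} → Pred (Fin N) 0ℓ → Set
MissedWindow m {N} P =
  ∃ λ i → i + m ≤ N × (∀ p → i ≤ toℕ p → toℕ p < i + m → ¬ P p)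

-- Induction on the number `n` of consecutive blocks of length `m`: either some block misses `P`, or
-- one hit is taken from each block, which gives exactly `n` elements.
transversal : ∀ (m n : ℕ) {P : Pred (Fin (n * m)) 0ℓ} → Decidable P →
              MissedWindow m P ⊎ ∃ λ s → ∣ s ∣ ≡ n × (∀ {x} → x ∈ˢ s → P x)
transversal m zero    P? = inj₂ ([] , refl , λ ())
transversal m (suc n) {P} P? with any? (P? ∘ (_↑ˡ n * m)) | transversal m n (P? ∘ (m ↑ʳ_))
... | no ¬hit | _ = inj₁ (0 , m≤m+n m (n * m) , λ p _ p<m → missed p p<m)
  where
  missed : ∀ p → toℕ p < m → ¬ P p
  missed p p<m Pp with splitAt m p in eq
  ... | inj₁ x = ¬hit (x , subst P (sym (splitAt⁻¹-↑ˡ eq)) Pp)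
  ... | inj₂ y = <⇒≱ p<m (subst (m ≤_)
    (trans (sym (toℕ-↑ʳ m y)) (cong toℕ (splitAt⁻¹-↑ʳ eq))) (m≤m+n m _))
-- A window missed in the remaining blocks is shifted by `m`, past the first block; the lower bound
-- `m + i` then excludes positions inside that block.
... | yes _ | inj₁ (i , i+m≤ , missed) =
  inj₁ (m + i , subst (_≤ m + n * m) (sym (+-assoc m i m)) (+-monoʳ-≤ m i+m≤) , missed′)
  where
  missed′ : ∀ p → m + i ≤ toℕ p → toℕ p < m + i + m → ¬ P p
  missed′ p lo hi Pp with splitAt m p in eq
  ... | inj₁ x with refl ← splitAt⁻¹-↑ˡ eq =
    <⇒≱ (toℕ<n x) (subst (m ≤_) (toℕ-↑ˡ x _) (m+n≤o⇒m≤o m lo))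
  ... | inj₂ y with refl ← splitAt⁻¹-↑ʳ {m} eq = missed y
    (+-cancelˡ-≤ m _ _ (subst (m + i ≤_) (toℕ-↑ʳ m y) lo))
    (+-cancelˡ-< m _ _ (subst (m + toℕ y <_) (+-assoc m i m) (subst (_< m + i + m) (toℕ-↑ʳ m y) hi)))
    Pp
... | yes (x , Px) | inj₂ (s , ∣s∣≡n , P-s) =
  inj₂ ( ⁅ x ⁆ ++ s
       , trans (∣p++q∣≡∣p∣+∣q∣ ⁅ x ⁆ s) (cong₂ _+_ (∣⁅x⁆∣≡1 x) ∣s∣≡n)
       , all-++ P ⁅ x ⁆ s (λ y∈ → subst (P ∘ (_↑ˡ n * m)) (sym (x∈⁅y⁆⇒x≡y x y∈)) Px) P-s )

isRed? : Decidable (_≡ red)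
isRed? red  = yes refl
isRed? blue = no λ ()

≢red⇒≡blue : ∀ {c} → ¬ c ≡ red → c ≡ blue
≢red⇒≡blue {red}  c≢red = contradiction refl c≢red
≢red⇒≡blue {blue} _     = refl

-- It suffices to ask for a vertex of the opposite color; this also covers the empty edge that
-- arises for `m = 0`.
monochromatic⇒¬polychromatic : ∀ {m} (H : UniformHypergraph m) φ {e} →
  e ∈ UniformHypergraph.Edge H → Monochromatic H φ e → ¬ Polychromatic H φ
monochromatic⇒¬polychromatic H φ {e} e∈ (red , mono) poly with poly e e∈ blue
... | v , v∈e , φv≡blue with () ← trans (sym (mono v v∈e)) φv≡blue
monochromatic⇒¬polychromatic H φ {e} e∈ (blue , mono) poly with poly e e∈ red
... | v , v∈e , φv≡red with () ← trans (sym (mono v v∈e)) φv≡red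

module _ (m : ℕ) (φ : Coloring (ℋ m)) where
  open Construction m

  MonochromaticEdge : Set₁
  MonochromaticEdge = ∃ λ e → e ∈ UniformHypergraph.Edge (ℋ m) × Monochromatic (ℋ m) φ e

  -- The number of disjoint blocks in a stage is exactly the cardinality that `T` demands of `S′`.
  size-suc : ∀ {j} → j < m → size j ≡ size (suc j) * m
  size-suc {j} j<m = trans (cong (m ^_) (+-∸-assoc 1 j<m)) (*-comm m (size (suc j)))

  RedSubset : ∀ {j} → Stage j → Set
  RedSubset {j} S = ∃ λ (S′ : Subset (size j)) →
    ∣ S′ ∣ ≡ size (suc j) × (∀ {p} → p ∈ˢ S′ → φ (vertex S p) ≡ red)

  redSubset : ∀ {j} → j < m → (S : Stage j) → MonochromaticEdge ⊎ RedSubset S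
  redSubset {j} j<m S = conclude (transversal′ (size-suc j<m) λ p → isRed? (φ (vertex S p)))
    where
    -- With `N` a variable the equation can be matched with `refl`, which avoids transporting
    -- subsets of `Fin (size j)`.
    transversal′ : ∀ {N n} {P : Pred (Fin N) 0ℓ} → N ≡ n * m → Decidable P →
      MissedWindow m P ⊎ ∃ λ s → ∣ s ∣ ≡ n × (∀ {x} → x ∈ˢ s → P x)
    transversal′ refl P? = transversal m _ P?

    conclude : MissedWindow m (λ p → φ (vertex S p) ≡ red) ⊎ RedSubset S →
               MonochromaticEdge ⊎ RedSubset S
    conclude (inj₂ s) = inj₂ s
    conclude (inj₁ (i , i+m≤ , ¬red)) = inj₁
      ( Window S i
      , inj₁ (j , S , i , i+m≤ , id , id)
      , blue , λ { v (p , refl , i≤p , p<i+m) → ≢red⇒≡blue (¬red p i≤p p<i+m) } )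

  -- The start `p` is existential because the path is assembled from the leaf upwards: its vertex in
  -- `S` is known only once the part below is.
  RedDescent : ∀ {j} → Stage j → Set
  RedDescent S = ∃ λ p → ∃ λ l → Leaf l × ∃ λ (π : Star _⟶_ (vertex S p) l) →
    ∀ v → v ∈ OnPath π → φ v ≡ red

  -- The recursion is on `d`, the number of levels below `S`, since the level itself grows.
  redDescent : ∀ d {j} → d + suc j ≡ m → (S : Stage j) → MonochromaticEdge ⊎ RedDescent S
  redDescent d {j} d+1+j≡m S with redSubset (subst (suc j ≤_) d+1+j≡m (m≤n+m (suc j) d)) S
  ... | inj₁ mono = inj₁ mono
  -- On the last level `size (suc j)` is `m ^ 0`, so `S′` is a single red vertex, and `1+j≡m` is
  -- literally the proof that it is a leaf.
  redDescent zero {j} 1+j≡m S | inj₂ (S′ , ∣S′∣≡ , red-S′) =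
    inj₂ (p , vertex S p , 1+j≡m , ε , λ { _ refl → red-S′ (enum-∈ S′ _) })
    where
    ∣S′∣≡1 : ∣ S′ ∣ ≡ 1
    ∣S′∣≡1 = trans ∣S′∣≡ (cong (m ^_) (trans (cong (m ∸_) 1+j≡m) (n∸n≡0 m)))

    p : Fin (size j)
    p = enum S′ (cast (sym ∣S′∣≡1) zero)
  redDescent (suc d) {j} eq S | inj₂ (S′ , ∣S′∣≡ , red-S′)
    with redDescent d (trans (+-suc d (suc j)) eq) (T 1+j<m S S′ ∣S′∣≡)
    where
    1+j<m : suc j < m
    1+j<m = subst (suc (suc j) ≤_) (trans (+-suc d (suc j)) eq) (m≤n+m (suc (suc j)) d)
  ... | inj₁ mono = inj₁ mono
  ... | inj₂ (p , l , leaf , π , red-π) =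
    -- The new start is the parent of `p`; it lies in `S′` and is therefore red.
    inj₂ (_ , l , leaf , child _ S S′ ∣S′∣≡ p ◅ π ,
      λ { _ (inj₁ refl) → red-S′ (enum-∈ S′ _)
        ; v (inj₂ v∈π)  → red-π v v∈π })

monochromaticEdge : ∀ m φ → MonochromaticEdge m φ
monochromaticEdge zero φ =
  -- For `m = 0` a window is empty, so it is vacuously monochromatic.
  Window roots 0 , inj₁ (0 , roots , 0 , z≤n , id , id) , red , λ { _ (_ , _ , _ , ()) }
  where open Construction 0
-- Below the roots there are `m` further levels, the uniformity being `suc m`.
monochromaticEdge (suc m) φ with redDescent (suc m) φ m (+-comm m 1) Construction.roots
... | inj₁ mono = mono
... | inj₂ (p , l , leaf , π , red-π) =
  OnPath π , inj₂ (vertex roots p , l , refl , leaf , π , id , id) , red , red-π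
  where open Construction (suc m)

theorem9 : (m : ℕ) →
    (¬ (∃ λ (φ : Coloring (ℋ m)) → Polychromatic (ℋ m) φ)) ×
    ((φ : Coloring (ℋ m)) →
    ∃ λ e → e ∈ UniformHypergraph.Edge (ℋ m) × Monochromatic (ℋ m) φ e)
theorem9 m = ¬polychromatic , monochromaticEdge m
  where
  ¬polychromatic : ¬ (∃ λ (φ : Coloring (ℋ m)) → Polychromatic (ℋ m) φ)
  ¬polychromatic (φ , poly) with monochromaticEdge m φ
  ... | _ , e∈ , mono = monochromatic⇒¬polychromatic (ℋ m) φ e∈ mono poly
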